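{- Let $\sigma$ be an $r$-signotope on $[n]$ with corresponding partial order $\prec$ on the $(r-1)$-subsets of $[n]$. Define $\mathcal{U}^\sigma_1=\{I: |I|=r-1,\,1\notin I,\,\sigma(I\cup\{1\})=+\}$, $\mathcal{D}^\sigma_1=\{I: |I|=r-1,\,1\notin I,\,\sigma(I\cup\{1\})=-\}$, $\mathcal{U}^\sigma_n=\{I: |I|=r-1,\,n\notin I,\,\sigma(I\cup\{n\})=-\}$, $\mathcal{D}^\sigma_n=\{I: |I|=r-1,\,n\notin I,\,\sigma(I\cup\{n\})=+\}$ (all $I\subseteq[n]$). Then $\mathcal{U}^\sigma_1$ and $\mathcal{U}^\sigma_n$ are up-sets and $\mathcal{D}^\sigma_1$ and $\mathcal{D}^\sigma_n$ are down-sets of $\prec$.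
   Context: An $r$-signotope on $[n]$ is a map $\sigma:\binom{[n]}{r}\to\{+,-\}$ such that for every $(r+1)$-subset $X=\{x_1<\dots<x_{r+1}\}$ the sequence $\sigma(X_1),\dots,\sigma(X_{r+1})$ has at most one sign change, where $X_j=X\setminus\{x_j\}$. The partial order corresponding to $\sigma$ is the transitive closure of the relations on $(r-1)$-subsets: for every $r$-subset $X=\{x_1<\dots<x_r\}$, $X_1\succ\dots\succ X_r$ if $\sigma(X)=+$ and $X_1\prec\dots\prec X_r$ if $\sigma(X)=-$. An up-set is a set $\mathcal{U}$ with $p\succeq u\in\mathcal{U}\Rightarrow p\in\mathcal{U}$; a down-set is a set $\mathcal{D}$ with $p\preceq d\in\mathcal{D}\Rightarrow p\in\mathcal{D}$. -}

module Defs where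

open import Data.Nat using (ℕ; zero; suc; _+_; _≤_)
open import Data.Bool using (Bool; true; false; if_then_else_)
open import Data.Fin using (Fin; zero; suc; fromℕ)
open import Data.Fin.Subset using (Subset; _∈_; _∉_; _∪_; _-_; ∣_∣; ⁅_⁆)
open import Data.Vec using ([]; _∷_)
open import Data.List using (List; []; _∷_; map)
open import Data.Sign using (Sign) renaming (_≟_ to _≟ₛ_)
open import Data.Sum using (_⊎_)
open import Data.Product using (Σ; _×_; ∃-syntax)
open import Relation.Nullary using (yes; no)
open import Relation.Binary.PropositionalEquality using (_≡_)
open import Relation.Binary.Construct.Closure.Transitive using (TransClosure)

-- The ground set [n] is Fin n (element 1 is 'zero', element n is the
-- last element of Fin n).  Subsets of [n] are 'Subset n'.

-- Elements of a subset listed in increasing order x₁ < x₂ < ... .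
elems : ∀ {n} → Subset n → List (Fin n)
elems {zero} [] = []
elems {suc n} (true ∷ p) = zero ∷ map suc (elems p)
elems {suc n} (false ∷ p) = map suc (elems p)

-- Number of sign changes in a sequence of signs.
changesFrom : Sign → List Sign → ℕ
changesFrom a [] = 0
changesFrom a (b ∷ xs) with a ≟ₛ b
... | yes _ = changesFrom b xs
... | no _ = suc (changesFrom b xs)

signChanges : List Sign → ℕ
signChanges [] = 0
signChanges (a ∷ xs) = changesFrom a xs

-- x and y occur consecutively (x immediately before y) in a list.
data Adjacent {A : Set} : List A → A → A → Set where
  here  : ∀ {x y xs} → Adjacent (x ∷ y ∷ xs) x y
  there : ∀ {z x y xs} → Adjacent xs x y → Adjacent (z ∷ xs) x y

-- An r-signotope on [n]; σ is a map on subsets, only its values on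
-- r-subsets are relevant/constrained.
IsSignotope : (n r : ℕ) → (Subset n → Sign) → Set
IsSignotope n r σ =
  ∀ (X : Subset n) → ∣ X ∣ ≡ suc r →
    signChanges (map (λ x → σ (X - x)) (elems X)) ≤ 1

-- Generating relation of the partial order: A ≺₀ B  (A below B).
-- For an r-subset X = {x₁<...<x_r} with X_i = X ∖ {x_i}:
--   σ(X) = +  gives  X₁ ≻ X₂ ≻ ... ≻ X_r, i.e. X_{i+1} ≺ X_i;
--   σ(X) = -  gives  X₁ ≺ X₂ ≺ ... ≺ X_r, i.e. X_i ≺ X_{i+1}.
data Step {n : ℕ} (r : ℕ) (σ : Subset n → Sign) : Subset n → Subset n → Set where
  plus  : ∀ (X : Subset n) {x y} → ∣ X ∣ ≡ r → Adjacent (elems X) x y →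
          σ X ≡ Sign.+ → Step r σ (X - y) (X - x)
  minus : ∀ (X : Subset n) {x y} → ∣ X ∣ ≡ r → Adjacent (elems X) x y →
          σ X ≡ Sign.- → Step r σ (X - x) (X - y)

-- The strict partial order ≺: transitive closure of Step.
Prec : ∀ {n} (r : ℕ) → (Subset n → Sign) → Subset n → Subset n → Set
Prec r σ = TransClosure (Step r σ)

-- Up-set / down-set of ≺ (p ⪰ u means p ≡ u or u ≺ p).
IsUpSet : ∀ {n} (r : ℕ) → (Subset n → Sign) → (Subset n → Set) → Set
IsUpSet r σ U = ∀ u p → U u → (p ≡ u ⊎ Prec r σ u p) → U p

IsDownSet : ∀ {n} (r : ℕ) → (Subset n → Sign) → (Subset n → Set) → Set
IsDownSet r σ D = ∀ d p → D d → (p ≡ d ⊎ Prec r σ p d) → D p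

-- The four families, for [n] = Fin (suc m), r = suc k (so r-1 = k).
-- 'first' is the element 1, 'last' is the element n.
U₁ D₁ Uₙ Dₙ : ∀ {m} (k : ℕ) → (Subset (suc m) → Sign) → Subset (suc m) → Set
U₁ k σ I = ∣ I ∣ ≡ k × zero ∉ I × σ (I ∪ ⁅ zero ⁆) ≡ Sign.+
D₁ k σ I = ∣ I ∣ ≡ k × zero ∉ I × σ (I ∪ ⁅ zero ⁆) ≡ Sign.-
Uₙ {m} k σ I = ∣ I ∣ ≡ k × fromℕ m ∉ I × σ (I ∪ ⁅ fromℕ m ⁆) ≡ Sign.-
Dₙ {m} k σ I = ∣ I ∣ ≡ k × fromℕ m ∉ I × σ (I ∪ ⁅ fromℕ m ⁆) ≡ Sign.+

-- It suffices that each family is closed under the generating relations, which compare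
-- X ∖ x and X ∖ y for an r-set X and consecutive elements x < y of X.  For the family
-- attached to z ∈ {1, n} with z ∉ X, put Y = X ∪ {z}: deleting z, x, y from Y gives X,
-- (X ∖ x) ∪ {z}, (X ∖ y) ∪ {z}, and these occur in the defining sequence of Y in the order
-- z, x, y when z = 1 and x, y, z when z = n.  That sequence changes sign at most once, so the
-- sign of σ(X), which orients the relation, and the sign on one side determine the sign on
-- the other.  If z ∈ X, then z is the deleted element, contradicting either the sign of σ(X)
-- or the fact that z sits at an end of X.
module Submission where

open import Defs
open import Data.Nat using (ℕ; zero; suc; _≤_; z≤n; s≤s; z<s; s<s)
open import Data.Nat.Properties using (≤-refl; ≤-trans; n≤1+n; m≤n⇒m≤1+n; <⇒≱; suc-injective)
open import Data.Bool using (true; false)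
open import Data.Fin using (Fin; zero; suc; fromℕ; _<_; _≟_)
open import Data.Fin.Properties using (≤fromℕ)
open import Data.Fin.Subset using (Subset; _∈_; _∉_; _∪_; _-_; ∣_∣; ⁅_⁆)
open import Data.Fin.Subset.Properties
  using (_∈?_; ∪-identityʳ; p─⊥≡p; p─q⊆p; x∈p∧x≢y⇒x∈p-y)
open import Data.Vec using ([]; _∷_; here; there)
open import Data.List using (List; []; _∷_; map; _++_)
open import Data.List.Properties using (map-++)
open import Data.List.Membership.Propositional using () renaming (_∈_ to _∈ₗ_)
open import Data.List.Membership.Propositional.Properties using (∈-map⁻)
open import Data.List.Relation.Unary.Any using (here; there)
open import Data.List.Relation.Unary.Linked as Linked using (Linked; []; [-]; _∷_)
import Data.List.Relation.Unary.Linked.Properties as Linkedₚ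
open import Data.List.Relation.Binary.Sublist.Propositional
  using (_⊆_; []; _∷_; _∷ʳ_; minimum; lookup)
open import Data.List.Relation.Binary.Sublist.Propositional.Properties using (map⁺; ++⁺)
open import Data.Sign using (Sign; opposite) renaming (_≟_ to _≟ₛ_)
open import Data.Sign.Properties using (s≢opposite[s])
open import Data.Sum using (_⊎_; inj₁; inj₂)
open import Data.Product using (_×_; _,_; proj₁; proj₂)
open import Data.Empty using (⊥-elim)
open import Function using (_∘_)
open import Relation.Nullary.Decidable using (yes; no; decidable-stable)
open import Relation.Binary.PropositionalEquality
  using (_≡_; _≢_; refl; sym; trans; cong; subst)
open import Relation.Binary.Construct.Closure.Transitive using (TransClosure; [_]; _∷_)

changesFrom≤1+changesFrom : ∀ a b xs → changesFrom a xs ≤ suc (changesFrom b xs)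
changesFrom≤1+changesFrom a b [] = z≤n
changesFrom≤1+changesFrom a b (c ∷ xs) with a ≟ₛ c | b ≟ₛ c
... | yes _ | yes _ = n≤1+n _
... | yes _ | no _  = m≤n⇒m≤1+n (n≤1+n _)
... | no _  | yes _ = ≤-refl
... | no _  | no _  = n≤1+n _

signChanges≤changesFrom : ∀ a xs → signChanges xs ≤ changesFrom a xs
signChanges≤changesFrom a [] = z≤n
signChanges≤changesFrom a (b ∷ xs) with a ≟ₛ b
... | yes _ = ≤-refl
... | no _  = n≤1+n _

changesFrom-mono-⊆ : ∀ a {xs ys} → xs ⊆ ys → changesFrom a xs ≤ changesFrom a ys
changesFrom-mono-⊆ a [] = z≤n
changesFrom-mono-⊆ a {xs} (y ∷ʳ xs⊆ys) with a ≟ₛ y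
... | yes refl = changesFrom-mono-⊆ a xs⊆ys
... | no _     = ≤-trans (changesFrom≤1+changesFrom a y xs) (s≤s (changesFrom-mono-⊆ y xs⊆ys))
changesFrom-mono-⊆ a (_∷_ {x} refl xs⊆ys) with a ≟ₛ x
... | yes _ = changesFrom-mono-⊆ x xs⊆ys
... | no _  = s≤s (changesFrom-mono-⊆ x xs⊆ys)

signChanges-mono-⊆ : ∀ {xs ys} → xs ⊆ ys → signChanges xs ≤ signChanges ys
signChanges-mono-⊆ [] = z≤n
signChanges-mono-⊆ {ys = y ∷ ys} (_ ∷ʳ xs⊆ys) =
  ≤-trans (signChanges-mono-⊆ xs⊆ys) (signChanges≤changesFrom y ys)
signChanges-mono-⊆ (_∷_ {x} refl xs⊆ys) = changesFrom-mono-⊆ x xs⊆ys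

-- Over two signs, "at most one sign change in a, b, c" is this disjunction.
Monotone₃ : Sign → Sign → Sign → Set
Monotone₃ a b c = a ≡ b ⊎ b ≡ c

signChanges≤1⇒Monotone₃ : ∀ {a b c} → signChanges (a ∷ b ∷ c ∷ []) ≤ 1 → Monotone₃ a b c
signChanges≤1⇒Monotone₃ {Sign.+} {Sign.+} _ = inj₁ refl
signChanges≤1⇒Monotone₃ {Sign.-} {Sign.-} _ = inj₁ refl
signChanges≤1⇒Monotone₃ {_} {Sign.+} {Sign.+} _ = inj₂ refl
signChanges≤1⇒Monotone₃ {_} {Sign.-} {Sign.-} _ = inj₂ refl
signChanges≤1⇒Monotone₃ {Sign.+} {Sign.-} {Sign.+} (s≤s ())
signChanges≤1⇒Monotone₃ {Sign.-} {Sign.+} {Sign.-} (s≤s ())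

Monotone₃-cong : ∀ {a a′ b b′ c c′} → a ≡ a′ → b ≡ b′ → c ≡ c′ →
                 Monotone₃ a b c → Monotone₃ a′ b′ c′
Monotone₃-cong refl refl refl m = m

Monotone₃-middle : ∀ {a b c s} → Monotone₃ a b c → a ≡ s → c ≡ s → b ≡ s
Monotone₃-middle (inj₁ a≡b) a≡s _ = trans (sym a≡b) a≡s
Monotone₃-middle (inj₂ b≡c) _ c≡s = trans b≡c c≡s

Monotone₃-right : ∀ {a b c s} → Monotone₃ a b c → a ≡ opposite s → b ≡ s → c ≡ s
Monotone₃-right (inj₁ a≡b) refl refl = ⊥-elim (s≢opposite[s] _ (sym a≡b))
Monotone₃-right (inj₂ b≡c) _ b≡s = trans (sym b≡c) b≡s

Monotone₃-left : ∀ {a b c s} → Monotone₃ a b c → b ≡ s → c ≡ opposite s → a ≡ s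
Monotone₃-left (inj₁ a≡b) b≡s _ = trans a≡b b≡s
Monotone₃-left (inj₂ b≡c) refl refl = ⊥-elim (s≢opposite[s] _ b≡c)

≡⇒≢opposite : ∀ {a s} → a ≡ s → a ≢ opposite s
≡⇒≢opposite refl = s≢opposite[s] _

Adjacent⇒⊆ : ∀ {A : Set} {xs : List A} {x y} → Adjacent xs x y → x ∷ y ∷ [] ⊆ xs
Adjacent⇒⊆ here = refl ∷ refl ∷ minimum _
Adjacent⇒⊆ (there adj) = _ ∷ʳ Adjacent⇒⊆ adj

Linked⇒Adjacent⇒R : ∀ {A : Set} {R : A → A → Set} {xs x y} →
                    Linked R xs → Adjacent xs x y → R x y
Linked⇒Adjacent⇒R (Rxy ∷ _) here = Rxy
Linked⇒Adjacent⇒R (_ ∷ linked) (there adj) = Linked⇒Adjacent⇒R linked adj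
Linked⇒Adjacent⇒R [-] (there ())

x∉p⇒∣p∪⁅x⁆∣≡1+∣p∣ : ∀ {n} {p : Subset n} {x} → x ∉ p → ∣ p ∪ ⁅ x ⁆ ∣ ≡ suc ∣ p ∣
x∉p⇒∣p∪⁅x⁆∣≡1+∣p∣ {p = true ∷ p} {zero} x∉p = ⊥-elim (x∉p here)
x∉p⇒∣p∪⁅x⁆∣≡1+∣p∣ {p = false ∷ p} {zero} _ = cong (suc ∘ ∣_∣) (∪-identityʳ p)
x∉p⇒∣p∪⁅x⁆∣≡1+∣p∣ {p = true ∷ p} {suc x} x∉p = cong suc (x∉p⇒∣p∪⁅x⁆∣≡1+∣p∣ (x∉p ∘ there))
x∉p⇒∣p∪⁅x⁆∣≡1+∣p∣ {p = false ∷ p} {suc x} x∉p = x∉p⇒∣p∪⁅x⁆∣≡1+∣p∣ (x∉p ∘ there)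

x∈p⇒1+∣p-x∣≡∣p∣ : ∀ {n} {p : Subset n} {x} → x ∈ p → suc ∣ p - x ∣ ≡ ∣ p ∣
x∈p⇒1+∣p-x∣≡∣p∣ {p = true ∷ p} here = cong (suc ∘ ∣_∣) (p─⊥≡p p)
x∈p⇒1+∣p-x∣≡∣p∣ {p = true ∷ p} (there x∈p) = cong suc (x∈p⇒1+∣p-x∣≡∣p∣ x∈p)
x∈p⇒1+∣p-x∣≡∣p∣ {p = false ∷ p} (there x∈p) = x∈p⇒1+∣p-x∣≡∣p∣ x∈p

x∉p⇒p∪⁅x⁆-x≡p : ∀ {n} {p : Subset n} {x} → x ∉ p → (p ∪ ⁅ x ⁆) - x ≡ p
x∉p⇒p∪⁅x⁆-x≡p {p = true ∷ p} {zero} x∉p = ⊥-elim (x∉p here)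
x∉p⇒p∪⁅x⁆-x≡p {p = false ∷ p} {zero} _ =
  cong (false ∷_) (trans (p─⊥≡p _) (∪-identityʳ p))
x∉p⇒p∪⁅x⁆-x≡p {p = true ∷ p} {suc x} x∉p = cong (true ∷_) (x∉p⇒p∪⁅x⁆-x≡p (x∉p ∘ there))
x∉p⇒p∪⁅x⁆-x≡p {p = false ∷ p} {suc x} x∉p = cong (false ∷_) (x∉p⇒p∪⁅x⁆-x≡p (x∉p ∘ there))

y≢x⇒p∪⁅x⁆-y≡p-y∪⁅x⁆ : ∀ {n} (p : Subset n) {x y} → y ≢ x →
                        (p ∪ ⁅ x ⁆) - y ≡ (p - y) ∪ ⁅ x ⁆
y≢x⇒p∪⁅x⁆-y≡p-y∪⁅x⁆ (b ∷ p) {zero} {zero} y≢x = ⊥-elim (y≢x refl)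
y≢x⇒p∪⁅x⁆-y≡p-y∪⁅x⁆ (b ∷ p) {suc x} {zero} _ =
  cong (false ∷_) (trans (p─⊥≡p _) (cong (_∪ ⁅ x ⁆) (sym (p─⊥≡p p))))
y≢x⇒p∪⁅x⁆-y≡p-y∪⁅x⁆ (b ∷ p) {zero} {suc y} _ =
  cong (_ ∷_) (trans (cong (_- y) (∪-identityʳ p)) (sym (∪-identityʳ _)))
y≢x⇒p∪⁅x⁆-y≡p-y∪⁅x⁆ (b ∷ p) {suc x} {suc y} y≢x =
  cong (_ ∷_) (y≢x⇒p∪⁅x⁆-y≡p-y∪⁅x⁆ p (y≢x ∘ cong suc))

x∈p⇒p-x∪⁅x⁆≡p : ∀ {n} {p : Subset n} {x} → x ∈ p → (p - x) ∪ ⁅ x ⁆ ≡ p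
x∈p⇒p-x∪⁅x⁆≡p {p = true ∷ p} here = cong (true ∷_) (trans (∪-identityʳ _) (p─⊥≡p p))
x∈p⇒p-x∪⁅x⁆≡p {p = true ∷ p} (there x∈p) = cong (true ∷_) (x∈p⇒p-x∪⁅x⁆≡p x∈p)
x∈p⇒p-x∪⁅x⁆≡p {p = false ∷ p} (there x∈p) = cong (false ∷_) (x∈p⇒p-x∪⁅x⁆≡p x∈p)

x∉p⇒x∉p-y : ∀ {n} {p : Subset n} {x y} → x ∉ p → x ∉ p - y
x∉p⇒x∉p-y {p = p} {y = y} x∉p = x∉p ∘ p─q⊆p p ⁅ y ⁆

x∈p∧x∉p-y⇒y≡x : ∀ {n} {p : Subset n} {x y} → x ∈ p → x ∉ p - y → y ≡ x
x∈p∧x∉p-y⇒y≡x {x = x} {y} x∈p x∉p-y =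
  decidable-stable (y ≟ x) (λ y≢x → x∉p-y (x∈p∧x≢y⇒x∈p-y x∈p (y≢x ∘ sym)))

mutual
  ∈-elems⁻ : ∀ {n} (p : Subset n) {x} → x ∈ₗ elems p → x ∈ p
  ∈-elems⁻ (true ∷ p) (here refl) = here
  ∈-elems⁻ (true ∷ p) (there x∈) = ∈-map-suc-elems⁻ p x∈
  ∈-elems⁻ (false ∷ p) x∈ = ∈-map-suc-elems⁻ p x∈

  ∈-map-suc-elems⁻ : ∀ {n b} (p : Subset n) {x} → x ∈ₗ map suc (elems p) → x ∈ b ∷ p
  ∈-map-suc-elems⁻ p x∈ with ∈-map⁻ suc x∈
  ... | _ , x∈p , refl = there (∈-elems⁻ p x∈p)

elems-increasing : ∀ {n} (p : Subset n) → Linked _<_ (elems p)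
elems-increasing [] = []
elems-increasing (true ∷ p) = zero∷map-suc-increasing (elems-increasing p)
  where
  zero∷map-suc-increasing : ∀ {xs} → Linked _<_ xs → Linked _<_ (zero ∷ map suc xs)
  zero∷map-suc-increasing {[]} _ = [-]
  zero∷map-suc-increasing {_ ∷ _} increasing = z<s ∷ Linkedₚ.map⁺ (Linked.map s<s increasing)
elems-increasing (false ∷ p) = Linkedₚ.map⁺ (Linked.map s<s (elems-increasing p))

elems-∪-zero : ∀ {n} {p : Subset (suc n)} → zero ∉ p → elems (p ∪ ⁅ zero ⁆) ≡ zero ∷ elems p
elems-∪-zero {p = true ∷ p} 0∉p = ⊥-elim (0∉p here)
elems-∪-zero {p = false ∷ p} _ = cong (λ q → zero ∷ map suc (elems q)) (∪-identityʳ p)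

elems-∪-fromℕ : ∀ {m} {p : Subset (suc m)} → fromℕ m ∉ p →
                elems (p ∪ ⁅ fromℕ m ⁆) ≡ elems p ++ (fromℕ m ∷ [])
elems-∪-fromℕ {zero} {true ∷ []} m∉p = ⊥-elim (m∉p here)
elems-∪-fromℕ {zero} {false ∷ []} _ = refl
elems-∪-fromℕ {suc m} {p = true ∷ p} m∉p =
  cong (zero ∷_) (trans (cong (map suc) (elems-∪-fromℕ (m∉p ∘ there))) (map-++ suc (elems p) _))
elems-∪-fromℕ {suc m} {p = false ∷ p} m∉p =
  trans (cong (map suc) (elems-∪-fromℕ (m∉p ∘ there))) (map-++ suc (elems p) _)

module _ {n} (p : Subset n) {x y} (adj : Adjacent (elems p) x y) where

  Adjacent-elems⇒< : x < y
  Adjacent-elems⇒< = Linked⇒Adjacent⇒R (elems-increasing p) adj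

  Adjacent-elems⇒∈ˡ : x ∈ p
  Adjacent-elems⇒∈ˡ = ∈-elems⁻ p (lookup (Adjacent⇒⊆ adj) (here refl))

  Adjacent-elems⇒∈ʳ : y ∈ p
  Adjacent-elems⇒∈ʳ = ∈-elems⁻ p (lookup (Adjacent⇒⊆ adj) (there (here refl)))

Adjacent-elems⇒≢zero : ∀ {n} (p : Subset (suc n)) {x y} → Adjacent (elems p) x y → y ≢ zero
Adjacent-elems⇒≢zero p adj refl with () ← Adjacent-elems⇒< p adj

Adjacent-elems⇒≢fromℕ : ∀ {m} (p : Subset (suc m)) {x y} → Adjacent (elems p) x y → x ≢ fromℕ m
Adjacent-elems⇒≢fromℕ p adj refl = <⇒≱ (Adjacent-elems⇒< p adj) (≤fromℕ _)

signotope-Monotone₃ : ∀ {n r σ} → IsSignotope n r σ → ∀ {q : Subset n} {a b c} →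
                      ∣ q ∣ ≡ suc r → a ∷ b ∷ c ∷ [] ⊆ elems q →
                      Monotone₃ (σ (q - a)) (σ (q - b)) (σ (q - c))
signotope-Monotone₃ {σ = σ} S {q} ∣q∣ abc =
  signChanges≤1⇒Monotone₃ (≤-trans (signChanges-mono-⊆ (map⁺ (λ w → σ (q - w)) abc)) (S q ∣q∣))

module _ {m r : ℕ} {σ : Subset (suc m) → Sign} (S : IsSignotope (suc m) r σ)
         {p : Subset (suc m)} (∣p∣ : ∣ p ∣ ≡ r) where

  private
    module _ {z} (z∉p : z ∉ p) where

      Monotone₃-∪ : ∀ {a b c} → a ∷ b ∷ c ∷ [] ⊆ elems (p ∪ ⁅ z ⁆) →
                    Monotone₃ (σ ((p ∪ ⁅ z ⁆) - a)) (σ ((p ∪ ⁅ z ⁆) - b)) (σ ((p ∪ ⁅ z ⁆) - c))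
      Monotone₃-∪ = signotope-Monotone₃ {σ = σ} S (trans (x∉p⇒∣p∪⁅x⁆∣≡1+∣p∣ z∉p) (cong suc ∣p∣))

      σ-remove-z : σ ((p ∪ ⁅ z ⁆) - z) ≡ σ p
      σ-remove-z = cong σ (x∉p⇒p∪⁅x⁆-x≡p z∉p)

      σ-remove : ∀ {w} → w ∈ p → σ ((p ∪ ⁅ z ⁆) - w) ≡ σ ((p - w) ∪ ⁅ z ⁆)
      σ-remove w∈p = cong σ (y≢x⇒p∪⁅x⁆-y≡p-y∪⁅x⁆ p (λ { refl → z∉p w∈p }))

  Monotone₃-∪-zero : ∀ {x y} → zero ∉ p → Adjacent (elems p) x y →
                     Monotone₃ (σ p) (σ ((p - x) ∪ ⁅ zero ⁆)) (σ ((p - y) ∪ ⁅ zero ⁆))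
  Monotone₃-∪-zero {x} {y} 0∉p adj =
    Monotone₃-cong (σ-remove-z 0∉p)
                   (σ-remove 0∉p (Adjacent-elems⇒∈ˡ p adj))
                   (σ-remove 0∉p (Adjacent-elems⇒∈ʳ p adj))
      (Monotone₃-∪ 0∉p (subst (zero ∷ x ∷ y ∷ [] ⊆_) (sym (elems-∪-zero 0∉p))
        (refl ∷ Adjacent⇒⊆ adj)))

  Monotone₃-∪-fromℕ : ∀ {x y} → fromℕ m ∉ p → Adjacent (elems p) x y →
                      Monotone₃ (σ ((p - x) ∪ ⁅ fromℕ m ⁆)) (σ ((p - y) ∪ ⁅ fromℕ m ⁆)) (σ p)
  Monotone₃-∪-fromℕ {x} {y} m∉p adj =
    Monotone₃-cong (σ-remove m∉p (Adjacent-elems⇒∈ˡ p adj))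
                   (σ-remove m∉p (Adjacent-elems⇒∈ʳ p adj))
                   (σ-remove-z m∉p)
      (Monotone₃-∪ m∉p (subst (x ∷ y ∷ fromℕ m ∷ [] ⊆_) (sym (elems-∪-fromℕ m∉p))
        (++⁺ (Adjacent⇒⊆ adj) (refl ∷ []))))

module _ {A : Set} {_∼_ : A → A → Set} {P : A → Set} where

  TransClosure-preserves : (∀ {x y} → P x → x ∼ y → P y) →
                           ∀ {x y} → P x → TransClosure _∼_ x y → P y
  TransClosure-preserves preserves Px [ x∼y ] = preserves Px x∼y
  TransClosure-preserves preserves Px (x∼y ∷ y∼⁺z) =
    TransClosure-preserves preserves (preserves Px x∼y) y∼⁺z

  TransClosure-reflects : (∀ {x y} → P y → x ∼ y → P x) →
                          ∀ {x y} → P y → TransClosure _∼_ x y → P x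
  TransClosure-reflects reflects Py [ x∼y ] = reflects Py x∼y
  TransClosure-reflects reflects Pz (x∼y ∷ y∼⁺z) =
    reflects (TransClosure-reflects reflects Pz y∼⁺z) x∼y

module _ {n r : ℕ} {σ : Subset n → Sign} where

  Step-closed⇒IsUpSet : ∀ {U : Subset n → Set} →
                        (∀ {u p} → U u → Step r σ u p → U p) → IsUpSet r σ U
  Step-closed⇒IsUpSet closed u p Uu (inj₁ refl) = Uu
  Step-closed⇒IsUpSet closed u p Uu (inj₂ u≺p) = TransClosure-preserves closed Uu u≺p

  Step-closed⇒IsDownSet : ∀ {D : Subset n → Set} →
                          (∀ {d p} → D d → Step r σ p d → D p) → IsDownSet r σ D
  Step-closed⇒IsDownSet closed d p Dd (inj₁ refl) = Dd
  Step-closed⇒IsDownSet closed d p Dd (inj₂ p≺d) = TransClosure-reflects closed Dd p≺d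

module Links {n} (k : ℕ) (σ : Subset n → Sign) where

  -- U₁, D₁, Uₙ and Dₙ are the instances z ∈ {1, n}, s ∈ {+, -} of this family.
  Link : Fin n → Sign → Subset n → Set
  Link z s I = ∣ I ∣ ≡ k × z ∉ I × σ (I ∪ ⁅ z ⁆) ≡ s

  Link-remove : ∀ {p z w s} → ∣ p ∣ ≡ suc k → z ∉ p → w ∈ p →
                σ ((p - w) ∪ ⁅ z ⁆) ≡ s → Link z s (p - w)
  Link-remove ∣p∣ z∉p w∈p σ≡s =
    suc-injective (trans (x∈p⇒1+∣p-x∣≡∣p∣ w∈p) ∣p∣) , x∉p⇒x∉p-y z∉p , σ≡s

  Link-remove-∈ : ∀ {p z w s} → Link z s (p - w) → z ∈ p → w ≡ z × σ p ≡ s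
  Link-remove-∈ (_ , z∉p-w , σ≡s) z∈p with refl ← x∈p∧x∉p-y⇒y≡x z∈p z∉p-w =
    refl , trans (cong σ (sym (x∈p⇒p-x∪⁅x⁆≡p z∈p))) σ≡s

module _ {m k : ℕ} {σ : Subset (suc m) → Sign} (S : IsSignotope (suc m) (suc k) σ) where

  open Links k σ

  U₁-Step-closed : ∀ {u p} → U₁ k σ u → Step (suc k) σ u p → U₁ k σ p
  U₁-Step-closed u@(_ , _ , σu) (plus X {y = y} ∣X∣ adj σX) with zero ∈? X
  ... | yes 0∈X = ⊥-elim (Adjacent-elems⇒≢zero X adj (proj₁ (Link-remove-∈ {w = y} u 0∈X)))
  ... | no 0∉X = Link-remove ∣X∣ 0∉X (Adjacent-elems⇒∈ˡ X adj)
                   (Monotone₃-middle (Monotone₃-∪-zero S ∣X∣ 0∉X adj) σX σu)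
  U₁-Step-closed u@(_ , _ , σu) (minus X {x} ∣X∣ adj σX) with zero ∈? X
  ... | yes 0∈X = ⊥-elim (≡⇒≢opposite (proj₂ (Link-remove-∈ {w = x} u 0∈X)) σX)
  ... | no 0∉X = Link-remove ∣X∣ 0∉X (Adjacent-elems⇒∈ʳ X adj)
                   (Monotone₃-right (Monotone₃-∪-zero S ∣X∣ 0∉X adj) σX σu)

  Uₙ-Step-closed : ∀ {u p} → Uₙ k σ u → Step (suc k) σ u p → Uₙ k σ p
  Uₙ-Step-closed u@(_ , _ , σu) (plus X {y = y} ∣X∣ adj σX) with fromℕ m ∈? X
  ... | yes m∈X = ⊥-elim (≡⇒≢opposite (proj₂ (Link-remove-∈ {w = y} u m∈X)) σX)
  ... | no m∉X = Link-remove ∣X∣ m∉X (Adjacent-elems⇒∈ˡ X adj)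
                   (Monotone₃-left (Monotone₃-∪-fromℕ S ∣X∣ m∉X adj) σu σX)
  Uₙ-Step-closed u@(_ , _ , σu) (minus X {x} ∣X∣ adj σX) with fromℕ m ∈? X
  ... | yes m∈X = ⊥-elim (Adjacent-elems⇒≢fromℕ X adj (proj₁ (Link-remove-∈ {w = x} u m∈X)))
  ... | no m∉X = Link-remove ∣X∣ m∉X (Adjacent-elems⇒∈ʳ X adj)
                   (Monotone₃-middle (Monotone₃-∪-fromℕ S ∣X∣ m∉X adj) σu σX)

  D₁-Step-closed : ∀ {d p} → D₁ k σ d → Step (suc k) σ p d → D₁ k σ p
  D₁-Step-closed d@(_ , _ , σd) (plus X {x} ∣X∣ adj σX) with zero ∈? X
  ... | yes 0∈X = ⊥-elim (≡⇒≢opposite (proj₂ (Link-remove-∈ {w = x} d 0∈X)) σX)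
  ... | no 0∉X = Link-remove ∣X∣ 0∉X (Adjacent-elems⇒∈ʳ X adj)
                   (Monotone₃-right (Monotone₃-∪-zero S ∣X∣ 0∉X adj) σX σd)
  D₁-Step-closed d@(_ , _ , σd) (minus X {y = y} ∣X∣ adj σX) with zero ∈? X
  ... | yes 0∈X = ⊥-elim (Adjacent-elems⇒≢zero X adj (proj₁ (Link-remove-∈ {w = y} d 0∈X)))
  ... | no 0∉X = Link-remove ∣X∣ 0∉X (Adjacent-elems⇒∈ˡ X adj)
                   (Monotone₃-middle (Monotone₃-∪-zero S ∣X∣ 0∉X adj) σX σd)

  Dₙ-Step-closed : ∀ {d p} → Dₙ k σ d → Step (suc k) σ p d → Dₙ k σ p
  Dₙ-Step-closed d@(_ , _ , σd) (plus X {x} ∣X∣ adj σX) with fromℕ m ∈? X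
  ... | yes m∈X = ⊥-elim (Adjacent-elems⇒≢fromℕ X adj (proj₁ (Link-remove-∈ {w = x} d m∈X)))
  ... | no m∉X = Link-remove ∣X∣ m∉X (Adjacent-elems⇒∈ʳ X adj)
                   (Monotone₃-middle (Monotone₃-∪-fromℕ S ∣X∣ m∉X adj) σd σX)
  Dₙ-Step-closed d@(_ , _ , σd) (minus X {y = y} ∣X∣ adj σX) with fromℕ m ∈? X
  ... | yes m∈X = ⊥-elim (≡⇒≢opposite (proj₂ (Link-remove-∈ {w = y} d m∈X)) σX)
  ... | no m∉X = Link-remove ∣X∣ m∉X (Adjacent-elems⇒∈ˡ X adj)
                   (Monotone₃-left (Monotone₃-∪-fromℕ S ∣X∣ m∉X adj) σd σX)

lemma14 : (m k : ℕ) (σ : Subset (suc m) → Sign) →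
    IsSignotope (suc m) (suc k) σ →
    IsUpSet (suc k) σ (U₁ k σ) × IsUpSet (suc k) σ (Uₙ k σ) ×
    IsDownSet (suc k) σ (D₁ k σ) × IsDownSet (suc k) σ (Dₙ k σ)
lemma14 m k σ S =
  Step-closed⇒IsUpSet (U₁-Step-closed S) , Step-closed⇒IsUpSet (Uₙ-Step-closed S) ,
  Step-closed⇒IsDownSet (D₁-Step-closed S) , Step-closed⇒IsDownSet (Dₙ-Step-closed S)
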